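{- For every graph $G$, $\hom(S_{2,1^0};G)^3\cdot\hom(S_{2,1^3};G)\ge \hom(S_{2,1^2};G)^3$.
   Context: All graphs are finite; $\hom(H;G)$ is the number of graph homomorphisms from $H$ to $G$. For $k\ge0$, $S_{2,1^k}$ is the tree with vertex set $\{1,\ldots,k+3\}$ and edge set $\{\{1,j\}:2\le j\le k+2\}\cup\{\{k+2,k+3\}\}$; in particular $S_{2,1^0}$ is the path with two edges. -}

module Defs where

open import Data.Nat using (ℕ; suc; _+_; _≤_; _≤?_; _^_; _≟_; s≤s)
open import Data.Nat.Properties using (+-cancelˡ-≡)
open import Data.Fin using (Fin; toℕ; finToFun)
open import Data.Fin.Properties using (all?)
open import Data.List using (length; filter; allFin)
open import Data.Product using (_×_; _,_)
open import Data.Sum using (_⊎_; inj₁; inj₂; swap)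
open import Level using (0ℓ)
open import Relation.Binary using (Rel; Symmetric; Irreflexive; Decidable)
open import Relation.Binary.PropositionalEquality using (_≡_; refl; sym; trans)
open import Relation.Nullary using (¬_; Dec)
open import Relation.Nullary.Decidable using (_×-dec_; _⊎-dec_; _→-dec_)

-- Finite simple graphs: no loops, no multiple edges; the graph with no
-- vertices is allowed.  Decidability makes homomorphisms countable.
record Graph : Set₁ where
  field
    order      : ℕ
    Adj        : Rel (Fin order) 0ℓ
    adj?       : Decidable Adj
    adj-sym    : Symmetric Adj
    adj-irrefl : Irreflexive _≡_ Adj

open Graph public

IsHom : (H G : Graph) → (Fin (order H) → Fin (order G)) → Set
IsHom H G f = ∀ u v → Adj H u v → Adj G (f u) (f v)

isHom? : (H G : Graph) (f : Fin (order H) → Fin (order G)) → Dec (IsHom H G f)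
isHom? H G f =
  all? λ u → all? λ v → adj? H u v →-dec adj? G (f u) (f v)

-- finToFun is, up to pointwise equality, a bijection from Fin (m ^ n) onto
-- the functions Fin n → Fin m, so each vertex map is tested exactly once.
hom : (H G : Graph) → ℕ
hom H G =
  length (filter (λ i → isHom? H G (finToFun i))
                 (allFin (order G ^ order H)))

-- The edges of S k on the labels 1, …, k + 3, each listed in one orientation.
SEdge : ℕ → Rel ℕ 0ℓ
SEdge k a b = (a ≡ 1 × 2 ≤ b × b ≤ k + 2) ⊎ (a ≡ k + 2 × b ≡ k + 3)

sEdge? : ∀ k → Decidable (SEdge k)
sEdge? k a b =
  (a ≟ 1 ×-dec (2 ≤? b ×-dec b ≤? k + 2)) ⊎-dec (a ≟ k + 2 ×-dec b ≟ k + 3)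

¬sEdge-diag : ∀ k a → ¬ SEdge k a a
¬sEdge-diag k _ (inj₁ (refl , s≤s () , _))
¬sEdge-diag k a (inj₂ (p , q)) with +-cancelˡ-≡ k 2 3 (trans (sym p) q)
... | ()

label : ∀ {n} → Fin n → ℕ
label i = suc (toℕ i)

-- The tree S_{2,1^k}: a centre 1 with k + 1 neighbours, of which k + 2 has
-- the further neighbour k + 3.
S : ℕ → Graph
S k = record
  { order      = k + 3
  ; Adj        = λ i j → SEdge k (label i) (label j) ⊎ SEdge k (label j) (label i)
  ; adj?       = λ i j → sEdge? k (label i) (label j) ⊎-dec sEdge? k (label j) (label i)
  ; adj-sym    = swap
  ; adj-irrefl = λ { {i} refl (inj₁ e) → ¬sEdge-diag k (label i) e
                   ; {i} refl (inj₂ e) → ¬sEdge-diag k (label i) e }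
  }

{-# OPTIONS --safe #-}

-- Write d(x) for the degree of x and w(x) for the sum of the degrees of its
-- neighbours, so that hₖ = hom(S_{2,1^k}) = Σ d^k w, and h₀ = Σ d².  Three uses
-- of Cauchy–Schwarz give, with t = Σ d² w²,
--   w(x)² ≤ d(x) h₀,   h₂² = (Σ d · d w)² ≤ h₀ t,
--   t² = (Σ d² w · w)² ≤ (Σ d² w)(Σ h₀ d³ w) = h₂ h₀ h₃,
-- where the middle factor of the last line uses d² w³ ≤ h₀ d³ w.  Hence
-- h₂⁴ ≤ h₀² t² ≤ h₂ h₀³ h₃, and one factor h₂ cancels.
module Submission where

open import Defs
open import Data.Bool using (true; false; if_then_else_)
open import Data.Fin using (Fin; zero; suc; toℕ; finToFun; combine; _↑ˡ_; _↑ʳ_)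
open import Data.Fin.Properties using (remQuot-combine)
open import Data.List using (length; filter; tabulate)
open import Data.Nat using (ℕ; zero; suc; _+_; _*_; _^_; _≤_; _≥_; z≤n; s≤s)
open import Data.Nat.Properties
open import Data.Nat.Solver using (module +-*-Solver)
open import Data.Nat.Tactic.RingSolver using (solve-∀)
open import Data.Product using (_×_; _,_; proj₁; proj₂)
open import Data.Sum using (_⊎_; inj₁; inj₂)
open import Data.Vec.Functional using (_∷_)
open import Function using (_∘_; _⇔_; mk⇔; Equivalence)
open import Relation.Binary.PropositionalEquality
open import Relation.Nullary using (Dec; does; yes; no; contradiction)
open import Relation.Nullary.Decidable using (_×-dec_)

open import Algebra.Properties.Semiring.Sum +-*-semiring
  using (sum; sum-syntax; sum-cong-≗; *-distribˡ-sum; *-distribʳ-sum; ∑-comm)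

private
  module Solver = +-*-Solver
  open Solver using (_:=_; _:*_; _:^_)

  variable
    m n : ℕ
    P Q : Set

-- Cauchy–Schwarz

sum-mono-≤ : {f g : Fin n → ℕ} → (∀ i → f i ≤ g i) → sum f ≤ sum g
sum-mono-≤ {zero}  f≤g = z≤n
sum-mono-≤ {suc n} f≤g = +-mono-≤ (f≤g zero) (sum-mono-≤ (f≤g ∘ suc))

square-cancel-≤ : ∀ a b → a * a ≤ b * b → a ≤ b
square-cancel-≤ a b a²≤b² = ≮⇒≥ λ b<a → <⇒≱ (*-mono-< b<a b<a) a²≤b²

-- The difference of the two sides is the square of `m - n`, which does not change when both
-- arguments drop by one. Induction on both at once avoids subtraction: each side grows by
-- `4 * (m + n + 1)`.
4*m*n≤[m+n]² : ∀ m n → 4 * (m * n) ≤ (m + n) * (m + n)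
4*m*n≤[m+n]² zero    n       = z≤n
4*m*n≤[m+n]² (suc m) zero    rewrite *-zeroʳ m = z≤n
4*m*n≤[m+n]² (suc m) (suc n) = begin
  4 * (suc m * suc n)                  ≡⟨ lhs m n ⟩
  4 * (m * n) + 4 * (m + n + 1)        ≤⟨ +-monoˡ-≤ _ (4*m*n≤[m+n]² m n) ⟩
  (m + n) * (m + n) + 4 * (m + n + 1)  ≡⟨ rhs m n ⟨
  (suc m + suc n) * (suc m + suc n)    ∎
  where
  open ≤-Reasoning
  lhs : ∀ m n → 4 * (suc m * suc n) ≡ 4 * (m * n) + 4 * (m + n + 1)
  lhs = solve-∀
  rhs : ∀ m n → (suc m + suc n) * (suc m + suc n) ≡ (m + n) * (m + n) + 4 * (m + n + 1)
  rhs = solve-∀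

-- Induction step of Cauchy-Schwarz. Only the cross term needs work: the square of `2 * (a * x)` is
-- at most four times the product of `b * z` and `y * c`, hence at most the square of their sum.
cauchy-schwarz-+ : ∀ a b c x y z → a * a ≤ b * c → x * x ≤ y * z →
                   (a + x) * (a + x) ≤ (b + y) * (c + z)
cauchy-schwarz-+ a b c x y z a²≤bc x²≤yz = begin
  (a + x) * (a + x)                    ≡⟨ lhs a x ⟩
  a * a + x * x + 2 * (a * x)          ≤⟨ +-mono-≤ (+-mono-≤ a²≤bc x²≤yz) cross ⟩
  b * c + y * z + (b * z + y * c)      ≡⟨ rhs b c y z ⟩
  (b + y) * (c + z)                    ∎
  where
  open ≤-Reasoning
  lhs : ∀ a x → (a + x) * (a + x) ≡ a * a + x * x + 2 * (a * x)
  lhs = solve-∀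
  rhs : ∀ b c y z → b * c + y * z + (b * z + y * c) ≡ (b + y) * (c + z)
  rhs = solve-∀
  cross₁ : ∀ a x → 2 * (a * x) * (2 * (a * x)) ≡ 4 * (a * a * (x * x))
  cross₁ = solve-∀
  cross₂ : ∀ b c y z → 4 * (b * c * (y * z)) ≡ 4 * (b * z * (y * c))
  cross₂ = solve-∀
  cross : 2 * (a * x) ≤ b * z + y * c
  cross = square-cancel-≤ _ _ (begin
    2 * (a * x) * (2 * (a * x))            ≡⟨ cross₁ a x ⟩
    4 * (a * a * (x * x))                  ≤⟨ *-monoʳ-≤ 4 (*-mono-≤ a²≤bc x²≤yz) ⟩
    4 * (b * c * (y * z))                  ≡⟨ cross₂ b c y z ⟩
    4 * (b * z * (y * c))                  ≤⟨ 4*m*n≤[m+n]² (b * z) (y * c) ⟩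
    (b * z + y * c) * (b * z + y * c)      ∎)

-- The pointwise hypothesis stands in for `f` being the product of the square roots of `g` and `h`,
-- so everything stays in the natural numbers.
cauchy-schwarz : (f g h : Fin n → ℕ) → (∀ i → f i * f i ≤ g i * h i) →
                 sum f * sum f ≤ sum g * sum h
cauchy-schwarz {zero}  f g h f²≤gh = z≤n
cauchy-schwarz {suc n} f g h f²≤gh =
  cauchy-schwarz-+ (f zero) (g zero) (h zero) _ _ _ (f²≤gh zero)
    (cauchy-schwarz (f ∘ suc) (g ∘ suc) (h ∘ suc) (f²≤gh ∘ suc))

-- Counting by indicators

⟦_⟧ : Dec P → ℕ
⟦ P? ⟧ = if does P? then 1 else 0

-- Allows one decision procedure to be exchanged for another, such as the one for homomorphisms for
-- `spider?`.
⟦⟧-cong : P ⇔ Q → (P? : Dec P) (Q? : Dec Q) → ⟦ P? ⟧ ≡ ⟦ Q? ⟧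
⟦⟧-cong P⇔Q (yes p) (yes q) = refl
⟦⟧-cong P⇔Q (yes p) (no ¬q) = contradiction (Equivalence.to P⇔Q p) ¬q
⟦⟧-cong P⇔Q (no ¬p) (yes q) = contradiction (Equivalence.from P⇔Q q) ¬p
⟦⟧-cong P⇔Q (no ¬p) (no ¬q) = refl

⟦⟧-× : (P? : Dec P) (Q? : Dec Q) → ⟦ P? ×-dec Q? ⟧ ≡ ⟦ P? ⟧ * ⟦ Q? ⟧
⟦⟧-× (yes p) Q? = sym (+-identityʳ ⟦ Q? ⟧)
⟦⟧-× (no ¬p) Q? = refl

⟦⟧-idem : (P? : Dec P) → ⟦ P? ⟧ * ⟦ P? ⟧ ≡ ⟦ P? ⟧
⟦⟧-idem (yes p) = refl
⟦⟧-idem (no ¬p) = refl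

length-filter-tabulate : {A : Set} {P : A → Set} (P? : ∀ x → Dec (P x)) (f : Fin n → A) →
                         length (filter P? (tabulate f)) ≡ ∑[ i < n ] ⟦ P? (f i) ⟧
length-filter-tabulate {zero}  P? f = refl
length-filter-tabulate {suc n} P? f with does (P? (f zero))
... | true  = cong suc (length-filter-tabulate P? (f ∘ suc))
... | false = length-filter-tabulate P? (f ∘ suc)

-- Sums over products and over function spaces.

sum-↑ : ∀ m {n} (f : Fin (m + n) → ℕ) →
        sum f ≡ ∑[ i < m ] f (i ↑ˡ n) + ∑[ j < n ] f (m ↑ʳ j)
sum-↑ zero    f = refl
sum-↑ (suc m) f = trans (cong (f zero +_) (sum-↑ m (f ∘ suc))) (sym (+-assoc (f zero) _ _))

sum-combine : ∀ m {n} (f : Fin (m * n) → ℕ) →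
              sum f ≡ ∑[ i < m ] ∑[ j < n ] f (combine i j)
sum-combine zero        f = refl
sum-combine (suc m) {n} f =
  trans (sum-↑ n f) (cong (∑[ j < n ] f (j ↑ˡ (m * n)) +_) (sum-combine m (f ∘ (n ↑ʳ_))))

-- An iterated sum, one coordinate at a time, so that a factor depending only on the first
-- coordinate can be pulled out.
sumFun : ∀ n → ((Fin n → Fin m) → ℕ) → ℕ
sumFun     zero    F = F λ ()
sumFun {m} (suc n) F = ∑[ i < m ] sumFun n λ g → F (i ∷ g)

finToFun-combine : (i : Fin m) (j : Fin (m ^ n)) →
                   finToFun {m} {suc n} (combine i j) ≗ i ∷ finToFun j
finToFun-combine i j zero    = cong proj₁ (remQuot-combine i j)
finToFun-combine i j (suc l) = cong (λ p → finToFun (proj₂ p) l) (remQuot-combine i j)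

∷-congʳ : (i : Fin m) {g h : Fin n → Fin m} → g ≗ h → i ∷ g ≗ i ∷ h
∷-congʳ i g≗h zero    = refl
∷-congʳ i g≗h (suc j) = g≗h j

-- `F` must respect pointwise equality because decoding `combine i j` agrees with `i ∷ finToFun j`
-- only pointwise.
sum-finToFun : ∀ n (F : (Fin n → Fin m) → ℕ) → (∀ {f g} → f ≗ g → F f ≡ F g) →
               ∑[ i < m ^ n ] F (finToFun i) ≡ sumFun n F
sum-finToFun     zero    F F-cong = trans (+-identityʳ _) (F-cong λ ())
sum-finToFun {m} (suc n) F F-cong = begin
  ∑[ i < m * m ^ n ] F (finToFun i)
    ≡⟨ sum-combine m (F ∘ finToFun) ⟩
  ∑[ i < m ] ∑[ j < m ^ n ] F (finToFun (combine i j))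
    ≡⟨ sum-cong-≗ (λ i → sum-cong-≗ λ j → F-cong (finToFun-combine i j)) ⟩
  ∑[ i < m ] ∑[ j < m ^ n ] F (i ∷ finToFun j)
    ≡⟨ sum-cong-≗ (λ i → sum-finToFun n (λ g → F (i ∷ g)) (F-cong ∘ ∷-congʳ i)) ⟩
  sumFun (suc n) F ∎
  where open ≡-Reasoning

sumFun-cong : ∀ n {F G : (Fin n → Fin m) → ℕ} → (∀ f → F f ≡ G f) → sumFun n F ≡ sumFun n G
sumFun-cong zero    F≗G = F≗G _
sumFun-cong (suc n) F≗G = sum-cong-≗ λ i → sumFun-cong n λ g → F≗G (i ∷ g)

sumFun-*ˡ : ∀ n c (F : (Fin n → Fin m) → ℕ) → sumFun n (λ f → c * F f) ≡ c * sumFun n F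
sumFun-*ˡ zero    c F = refl
sumFun-*ˡ (suc n) c F =
  trans (sum-cong-≗ λ i → sumFun-*ˡ n c λ g → F (i ∷ g)) (sym (*-distribˡ-sum c λ i → sumFun n λ g → F (i ∷ g)))

-- Homomorphism counts as degree sums

module _ (G : Graph) where

  private
    V : Set
    V = Fin (order G)

    ∑V : (V → ℕ) → ℕ
    ∑V = sum

  adj : V → V → ℕ
  adj x y = ⟦ adj? G x y ⟧

  deg : V → ℕ
  deg x = ∑V λ y → adj x y

  nbrDeg : V → ℕ
  nbrDeg x = ∑V λ y → adj x y * deg y

  adj-comm : ∀ x y → adj x y ≡ adj y x
  adj-comm x y = ⟦⟧-cong (mk⇔ (adj-sym G) (adj-sym G)) (adj? G x y) (adj? G y x)

  -- Both sides count walks with two edges, by an end vertex on the left and by the middle vertex on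
  -- the right.
  ∑-nbrDeg : ∑V nbrDeg ≡ ∑V λ x → deg x * deg x
  ∑-nbrDeg = begin
    ∑V (λ x → ∑V λ y → adj x y * deg y)  ≡⟨ ∑-comm (λ x y → adj x y * deg y) ⟩
    ∑V (λ y → ∑V λ x → adj x y * deg y)
      ≡⟨ sum-cong-≗ (λ y → sum-cong-≗ λ x → cong (_* deg y) (adj-comm x y)) ⟩
    ∑V (λ y → ∑V λ x → adj y x * deg y)
      ≡⟨ sum-cong-≗ (λ y → *-distribʳ-sum (deg y) (adj y)) ⟨
    ∑V (λ y → deg y * deg y)              ∎
    where open ≡-Reasoning

  -- The edges of S k other than those of the k leaves 2, …, k + 1 at the
  -- centre are {1, k + 2} and {k + 2, k + 3}; g maps the label i + 2 to g i.
  Spider : ∀ k → V → (Fin (2 + k) → V) → Set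
  Spider zero    x g = Adj G x (g zero) × Adj G (g zero) (g (suc zero))
  Spider (suc k) x g = Adj G x (g zero) × Spider k x (g ∘ suc)

  spider? : ∀ k x g → Dec (Spider k x g)
  spider? zero    x g = adj? G x (g zero) ×-dec adj? G (g zero) (g (suc zero))
  spider? (suc k) x g = adj? G x (g zero) ×-dec spider? k x (g ∘ suc)

  Spider-resp-≗ : ∀ k {x y g h} → x ≡ y → g ≗ h → Spider k x g → Spider k y h
  Spider-resp-≗ zero    refl g≗h (p , q) =
    subst (Adj G _) (g≗h zero) p , subst₂ (Adj G) (g≗h zero) (g≗h (suc zero)) q
  Spider-resp-≗ (suc k) refl g≗h (p , s) =
    subst (Adj G _) (g≗h zero) p , Spider-resp-≗ k refl (g≗h ∘ suc) s

  -- Index form of `Spider`, halfway to the labels of `SEdge`: indices up to `k` are the labels 2 to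
  -- `k + 2`, and indices `k` and `suc k` carry the tail edge.
  Spider′ : ∀ k → V → (Fin (2 + k) → V) → Set
  Spider′ k x g = (∀ i → toℕ i ≤ k → Adj G x (g i)) ×
                  (∀ i j → toℕ i ≡ k → toℕ j ≡ suc k → Adj G (g i) (g j))

  spider⇒spider′ : ∀ k {x g} → Spider k x g → Spider′ k x g
  spider⇒spider′ zero (p , q) =
    (λ { zero _ → p }) , λ { zero (suc zero) _ _ → q }
  spider⇒spider′ (suc k) (p , s) with spider⇒spider′ k s
  ... | legs , tail =
    (λ { zero _ → p ; (suc i) (s≤s i≤k) → legs i i≤k }) ,
    λ { (suc i) (suc j) i≡k j≡1+k → tail i j (suc-injective i≡k) (suc-injective j≡1+k) }

  spider′⇒spider : ∀ k {x g} → Spider′ k x g → Spider k x g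
  spider′⇒spider zero    (legs , tail) = legs zero z≤n , tail zero (suc zero) refl refl
  spider′⇒spider (suc k) (legs , tail) =
    legs zero z≤n ,
    spider′⇒spider k ((λ i i≤k → legs (suc i) (s≤s i≤k)) ,
                      λ i j i≡k j≡1+k → tail (suc i) (suc j) (cong suc i≡k) (cong suc j≡1+k))

  -- `IsHom (S k) G` unfolded, with the number of vertices left free so that `k + 3` can be replaced
  -- by `3 + k`.
  IsSHom : ∀ k n → (Fin n → V) → Set
  IsSHom k n f = ∀ u v → SEdge k (label u) (label v) ⊎ SEdge k (label v) (label u) →
                 Adj G (f u) (f v)

  isSHom⇒spider′ : ∀ k {f} → IsSHom k (3 + k) f → Spider′ k (f zero) (f ∘ suc)
  isSHom⇒spider′ k hf =
    (λ i i≤k → hf zero (suc i) (inj₁ (inj₁ (refl , s≤s (s≤s z≤n) ,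
       subst (2 + toℕ i ≤_) (+-comm 2 k) (s≤s (s≤s i≤k)))))) ,
    λ i j i≡k j≡1+k → hf (suc i) (suc j) (inj₁ (inj₂
      (trans (cong (2 +_) i≡k) (+-comm 2 k) , trans (cong (2 +_) j≡1+k) (+-comm 3 k))))

  spider′⇒sEdge : ∀ k {f} → Spider′ k (f zero) (f ∘ suc) → (u v : Fin (3 + k)) →
                  SEdge k (label u) (label v) → Adj G (f u) (f v)
  -- Once the sums start with a numeral, clashing label equations rule out all cases except a centre
  -- edge, the tail edge and a loop at the centre, which fails the bound `2 ≤ b`.
  spider′⇒sEdge k s u v e rewrite +-comm k 2 | +-comm k 3 with u | v | e
  ... | zero  | zero  | inj₁ (_ , s≤s () , _)
  ... | zero  | suc j | inj₁ (_ , _ , s≤s (s≤s j≤k)) = proj₁ s j j≤k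
  ... | suc i | suc j | inj₂ (i≡ , j≡) =
    proj₂ s i j (suc-injective (suc-injective i≡)) (suc-injective (suc-injective j≡))

  spider′⇒isSHom : ∀ k {f} → Spider′ k (f zero) (f ∘ suc) → IsSHom k (3 + k) f
  spider′⇒isSHom k s u v (inj₁ e) = spider′⇒sEdge k s u v e
  spider′⇒isSHom k s u v (inj₂ e) = adj-sym G (spider′⇒sEdge k s v u e)

  isSHom⇔spider : ∀ k {f} → IsSHom k (3 + k) f ⇔ Spider k (f zero) (f ∘ suc)
  isSHom⇔spider k =
    mk⇔ (spider′⇒spider k ∘ isSHom⇒spider′ k) (spider′⇒isSHom k ∘ spider⇒spider′ k)

  -- With the centre fixed at `x`, each of the `k` leaves ranges independently over the neighbours
  -- of `x`, and the remaining two vertices trace a walk counted by `nbrDeg x`.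
  sumFun-spider : ∀ k x → sumFun (2 + k) (λ g → ⟦ spider? k x g ⟧) ≡ deg x ^ k * nbrDeg x
  sumFun-spider zero x = begin
    ∑V (λ y → ∑V λ z → ⟦ adj? G x y ×-dec adj? G y z ⟧)
      ≡⟨ sum-cong-≗ (λ y → sum-cong-≗ λ z → ⟦⟧-× (adj? G x y) (adj? G y z)) ⟩
    ∑V (λ y → ∑V λ z → adj x y * adj y z)
      ≡⟨ sum-cong-≗ (λ y → *-distribˡ-sum (adj x y) (adj y)) ⟨
    nbrDeg x        ≡⟨ *-identityˡ (nbrDeg x) ⟨
    1 * nbrDeg x    ∎
    where open ≡-Reasoning
  sumFun-spider (suc k) x = begin
    ∑V (λ y → sumFun (2 + k) λ g → ⟦ adj? G x y ×-dec spider? k x g ⟧)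
      ≡⟨ sum-cong-≗ (λ y → sumFun-cong (2 + k) λ g → ⟦⟧-× (adj? G x y) (spider? k x g)) ⟩
    ∑V (λ y → sumFun (2 + k) λ g → adj x y * ⟦ spider? k x g ⟧)
      ≡⟨ sum-cong-≗ (λ y → sumFun-*ˡ (2 + k) (adj x y) λ g → ⟦ spider? k x g ⟧) ⟩
    ∑V (λ y → adj x y * sumFun (2 + k) λ g → ⟦ spider? k x g ⟧)
      ≡⟨ *-distribʳ-sum _ (adj x) ⟨
    deg x * sumFun (2 + k) (λ g → ⟦ spider? k x g ⟧)
      ≡⟨ cong (deg x *_) (sumFun-spider k x) ⟩
    deg x * (deg x ^ k * nbrDeg x)
      ≡⟨ *-assoc (deg x) (deg x ^ k) (nbrDeg x) ⟨
    deg x ^ suc k * nbrDeg x ∎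
    where open ≡-Reasoning

  -- Stated for any n equal to 3 + k because the order of S k is k + 3.
  count-isSHom : ∀ k {n} → n ≡ 3 + k → (isSHom? : ∀ f → Dec (IsSHom k n f)) →
                 ∑[ i < order G ^ n ] ⟦ isSHom? (finToFun i) ⟧ ≡ ∑V λ x → deg x ^ k * nbrDeg x
  count-isSHom k refl isSHom? = begin
    ∑[ i < order G ^ (3 + k) ] ⟦ isSHom? (finToFun i) ⟧
      ≡⟨ sum-cong-≗ (λ i → ⟦⟧-cong (isSHom⇔spider k) (isSHom? (finToFun i)) (spiderAt? (finToFun i))) ⟩
    ∑[ i < order G ^ (3 + k) ] ⟦ spiderAt? (finToFun i) ⟧
      ≡⟨ sum-finToFun (3 + k) (λ f → ⟦ spiderAt? f ⟧) spiderAt-cong ⟩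
    ∑V (λ x → sumFun (2 + k) λ g → ⟦ spider? k x g ⟧)
      ≡⟨ sum-cong-≗ (sumFun-spider k) ⟩
    ∑V (λ x → deg x ^ k * nbrDeg x) ∎
    where
    open ≡-Reasoning
    spiderAt? : ∀ f → Dec (Spider k (f zero) (f ∘ suc))
    spiderAt? f = spider? k (f zero) (f ∘ suc)
    spiderAt-cong : ∀ {f g} → f ≗ g → ⟦ spiderAt? f ⟧ ≡ ⟦ spiderAt? g ⟧
    spiderAt-cong {f} {g} f≗g = ⟦⟧-cong
      (mk⇔ (Spider-resp-≗ k (f≗g zero) (f≗g ∘ suc))
           (Spider-resp-≗ k (sym (f≗g zero)) (sym ∘ f≗g ∘ suc)))
      (spiderAt? f) (spiderAt? g)

  hom-S : ∀ k → hom (S k) G ≡ ∑V λ x → deg x ^ k * nbrDeg x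
  hom-S k = trans
    (length-filter-tabulate (λ i → isHom? (S k) G (finToFun i)) (λ i → i))
    (count-isSHom k (+-comm k 3) (isHom? (S k) G))

  hom-S₀ : hom (S 0) G ≡ ∑V λ x → deg x * deg x
  hom-S₀ = trans (hom-S 0) (trans (sum-cong-≗ λ x → *-identityˡ (nbrDeg x)) ∑-nbrDeg)

  -- Inequalities between the degree sums.

  private
    h₀ h₂ h₃ t : ℕ
    h₀ = ∑V λ x → deg x * deg x
    h₂ = ∑V λ x → deg x ^ 2 * nbrDeg x
    h₃ = ∑V λ x → deg x ^ 3 * nbrDeg x
    t  = ∑V λ x → deg x ^ 2 * nbrDeg x ^ 2

  -- Since `adj x y` is 0 or 1, the square of `adj x y * deg y` splits as `adj x y` times
  -- `deg y * deg y`; the second factor is summed over all vertices, giving `h₀`.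
  nbrDeg²≤ : ∀ x → nbrDeg x * nbrDeg x ≤ deg x * h₀
  nbrDeg²≤ x = cauchy-schwarz (λ y → adj x y * deg y) (adj x) (λ y → deg y * deg y) λ y →
    ≤-reflexive (trans (regroup (adj x y) (deg y))
                       (cong (_* (deg y * deg y)) (⟦⟧-idem (adj? G x y))))
    where
    regroup : ∀ a d → a * d * (a * d) ≡ a * a * (d * d)
    regroup = solve-∀

  h₂²≤ : h₂ * h₂ ≤ h₀ * t
  h₂²≤ = cauchy-schwarz _ (λ x → deg x * deg x) (λ x → deg x ^ 2 * nbrDeg x ^ 2) λ x →
    ≤-reflexive (regroup (deg x) (nbrDeg x))
    where
    regroup : ∀ d w → d ^ 2 * w * (d ^ 2 * w) ≡ d * d * (d ^ 2 * w ^ 2)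
    regroup = Solver.solve 2 (λ d w → d :^ 2 :* w :* (d :^ 2 :* w) := d :* d :* (d :^ 2 :* w :^ 2)) refl

  t²≤ : t * t ≤ h₂ * (h₀ * h₃)
  t²≤ = begin
    t * t                                             ≤⟨ cauchy-schwarz _ _ _ pointwise ⟩
    h₂ * ∑V (λ x → h₀ * (deg x ^ 3 * nbrDeg x))       ≡⟨ cong (h₂ *_) (*-distribˡ-sum h₀ λ x → deg x ^ 3 * nbrDeg x) ⟨
    h₂ * (h₀ * h₃)                                    ∎
    where
    open ≤-Reasoning
    lhs : ∀ d w → d ^ 2 * w ^ 2 * (d ^ 2 * w ^ 2) ≡ d ^ 4 * w ^ 2 * (w * w)
    lhs = Solver.solve 2 (λ d w → d :^ 2 :* w :^ 2 :* (d :^ 2 :* w :^ 2) := d :^ 4 :* w :^ 2 :* (w :* w)) refl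
    rhs : ∀ d w h → d ^ 4 * w ^ 2 * (d * h) ≡ d ^ 2 * w * (h * (d ^ 3 * w))
    rhs = Solver.solve 3 (λ d w h → d :^ 4 :* w :^ 2 :* (d :* h) := d :^ 2 :* w :* (h :* (d :^ 3 :* w))) refl
    pointwise : ∀ x → let d = deg x; w = nbrDeg x in
                d ^ 2 * w ^ 2 * (d ^ 2 * w ^ 2) ≤ d ^ 2 * w * (h₀ * (d ^ 3 * w))
    pointwise x = begin
      d ^ 2 * w ^ 2 * (d ^ 2 * w ^ 2)   ≡⟨ lhs d w ⟩
      d ^ 4 * w ^ 2 * (w * w)           ≤⟨ *-monoʳ-≤ (d ^ 4 * w ^ 2) (nbrDeg²≤ x) ⟩
      d ^ 4 * w ^ 2 * (d * h₀)          ≡⟨ rhs d w h₀ ⟩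
      d ^ 2 * w * (h₀ * (d ^ 3 * w))    ∎
      where
      d = deg x
      w = nbrDeg x

  h₂³≤ : h₂ ^ 3 ≤ h₀ ^ 3 * h₃
  h₂³≤ = cancel h₂ h₀ h₃ t h₂²≤ t²≤
    where
    lhs : ∀ a → a * a ^ 3 ≡ a * a * (a * a)
    lhs = Solver.solve 1 (λ a → a :* a :^ 3 := a :* a :* (a :* a)) refl
    mid : ∀ b t → b * t * (b * t) ≡ b * b * (t * t)
    mid = solve-∀
    rhs : ∀ a b c → b * b * (a * (b * c)) ≡ a * (b ^ 3 * c)
    rhs = Solver.solve 3 (λ a b c → b :* b :* (a :* (b :* c)) := a :* (b :^ 3 :* c)) refl
    cancel : ∀ a b c t → a * a ≤ b * t → t * t ≤ a * (b * c) → a ^ 3 ≤ b ^ 3 * c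
    -- Cancelling `a` requires it to be positive; for zero the left side vanishes.
    cancel zero      b c t _     _     = z≤n
    cancel a@(suc _) b c t a²≤bt t²≤abc = *-cancelˡ-≤ a (begin
      a * a ^ 3                ≡⟨ lhs a ⟩
      a * a * (a * a)          ≤⟨ *-mono-≤ a²≤bt a²≤bt ⟩
      b * t * (b * t)          ≡⟨ mid b t ⟩
      b * b * (t * t)          ≤⟨ *-monoʳ-≤ (b * b) t²≤abc ⟩
      b * b * (a * (b * c))    ≡⟨ rhs a b c ⟩
      a * (b ^ 3 * c)          ∎)
      where open ≤-Reasoning

theorem3p2 : (G : Graph) → hom (S 0) G ^ 3 * hom (S 3) G ≥ hom (S 2) G ^ 3
theorem3p2 G rewrite hom-S₀ G | hom-S G 2 | hom-S G 3 = h₂³≤ G
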